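{- An isolate-free graph $G$ is $\gamma_{tg}$-perfect if and only if it is $(P_4,\overline{2P_3})$-free, i.e. $G$ contains neither the path $P_4$ nor the complement $\overline{2P_3}$ of the disjoint union of two paths $P_3$ as an induced subgraph.
   Context: Graphs are finite, simple, undirected, with at least one vertex, not necessarily connected. $P_n$ is the path on $n$ vertices. A graph is isolate-free if it has no vertex of degree $0$. A vertex totally dominates its neighbors (not itself). For an isolate-free graph $G$, $\gamma_t(G)$ is the total domination number, i.e. the minimum size of a set $S\subseteq V(G)$ such that every vertex of $G$ has a neighbor in $S$. Total domination game on an isolate-free graph $G$: Dominator and Staller alternately select vertices; each selected vertex must totally dominate at least one vertex not totally dominated by the previously selected vertices. The game ends when no legal move exists. Dominator wants to minimize and Staller to maximize the total number of moves. $\gamma_{tg}(G)$ is the number of moves under optimal play when Dominator starts. $G$ is $\gamma_{tg}$-perfect if every isolate-free induced subgraph $F$ of $G$ satisfies $\gamma_{tg}(F)=\gamma_t(F)$. -}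

module Defs where

open import Data.Fin.Base using (Fin; toℕ; splitAt)
open import Data.Fin.Properties using () renaming (_≟_ to _≟ᶠ_)
open import Data.Fin.Subset using (Subset; _∈_; _∪_; ⁅_⁆; ∣_∣; ⊥)
open import Data.Nat.Base using (ℕ; suc; _+_; _≤_; NonZero)
open import Data.Nat.Properties using (_≟_; 1+n≢n)
open import Data.Product.Base using (_×_; _,_; ∃-syntax)
open import Data.Sum.Base using (_⊎_; inj₁; inj₂; swap)
open import Data.Sum.Relation.Binary.Pointwise
  using (Pointwise; inj₁; inj₂; ⊎-symmetric; ⊎-decidable)
open import Function.Bundles using (_⇔_)
open import Function.Definitions using (Injective)
open import Level using (0ℓ)
open import Relation.Binary.Core using (Rel)
open import Relation.Binary.Definitions using (Symmetric; Irreflexive; Decidable)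
open import Relation.Binary.PropositionalEquality using (_≡_; _≢_; refl; sym)
open import Relation.Nullary.Decidable using (_×-dec_; _⊎-dec_; ¬?)
open import Relation.Nullary.Negation using (¬_)

-- The vertex set is Fin n; the null graph is excluded.
record Graph (n : ℕ) : Set₁ where
  field
    nonEmpty : NonZero n
    _~_      : Rel (Fin n) 0ℓ
    ~-sym    : Symmetric _~_
    ~-irrefl : Irreflexive _≡_ _~_
    _~?_     : Decidable _~_

path : (n : ℕ) → {{NonZero n}} → Graph n
path n {{nz}} = record
  { nonEmpty = nz
  ; _~_      = λ i j → (suc (toℕ i) ≡ toℕ j) ⊎ (suc (toℕ j) ≡ toℕ i)
  ; ~-sym    = swap
  ; ~-irrefl = λ { refl (inj₁ e) → 1+n≢n e ; refl (inj₂ e) → 1+n≢n e }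
  ; _~?_     = λ i j → (suc (toℕ i) ≟ toℕ j) ⊎-dec (suc (toℕ j) ≟ toℕ i)
  }

complement : ∀ {n} → Graph n → Graph n
complement G = record
  { nonEmpty = G.nonEmpty
  ; _~_      = λ x y → x ≢ y × ¬ (x G.~ y)
  ; ~-sym    = λ (x≢y , x≁y) → (λ y≡x → x≢y (sym y≡x)) , (λ y~x → x≁y (G.~-sym y~x))
  ; ~-irrefl = λ x≡y (x≢y , _) → x≢y x≡y
  ; _~?_     = λ x y → ¬? (x ≟ᶠ y) ×-dec ¬? (x G.~? y)
  }
  where module G = Graph G

disjointUnion : ∀ {m n} → Graph m → Graph n → Graph (m + n)
disjointUnion {m} {n} G H = record
  { nonEmpty = +-nonZero G.nonEmpty
  ; _~_      = λ x y → splitAt m x ≈ splitAt m y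
  ; ~-sym    = ⊎-symmetric G.~-sym H.~-sym
  ; ~-irrefl = λ { refl → irrefl _ }
  ; _~?_     = λ x y → ⊎-decidable G._~?_ H._~?_ (splitAt m x) (splitAt m y)
  }
  where
  module G = Graph G
  module H = Graph H

  _≈_ : Rel (Fin m ⊎ Fin n) 0ℓ
  _≈_ = Pointwise G._~_ H._~_

  irrefl : ∀ s → ¬ (s ≈ s)
  irrefl _ (inj₁ x~x) = G.~-irrefl refl x~x
  irrefl _ (inj₂ x~x) = H.~-irrefl refl x~x

  +-nonZero : ∀ {k} → NonZero k → NonZero (k + n)
  +-nonZero {suc _} _ = _

-- H is isomorphic to the subgraph of G induced by the image of f.
_InducedSubgraphOf_ : ∀ {m n} → Graph m → Graph n → Set
_InducedSubgraphOf_ {m} {n} H G =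
  ∃[ f ] Injective {A = Fin m} {B = Fin n} _≡_ _≡_ f
       × (∀ x y → (x H.~ y) ⇔ (f x G.~ f y))
  where
  module G = Graph G
  module H = Graph H

_-Free_ : ∀ {m n} → Graph m → Graph n → Set
H -Free G = ¬ (H InducedSubgraphOf G)

data Player : Set where
  dominator staller : Player

opponent : Player → Player
opponent dominator = staller
opponent staller   = dominator

-- Player p likes a game of j moves at least as much as one of k moves.
Prefers : Player → ℕ → ℕ → Set
Prefers dominator j k = j ≤ k
Prefers staller   j k = k ≤ j

module _ {n : ℕ} (G : Graph n) where
  open Graph G

  IsolateFree : Set
  IsolateFree = ∀ v → ∃[ u ] v ~ u

  TotallyDominates : Subset n → Fin n → Set
  TotallyDominates S u = ∃[ w ] w ∈ S × w ~ u

  TotalDominatingSet : Subset n → Set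
  TotalDominatingSet S = ∀ u → TotallyDominates S u

  IsTotalDominationNumber : ℕ → Set
  IsTotalDominationNumber k =
      (∃[ S ] TotalDominatingSet S × ∣ S ∣ ≡ k)
    × (∀ S → TotalDominatingSet S → k ≤ ∣ S ∣)

  -- S is the set of previously selected vertices.
  Legal : Subset n → Fin n → Set
  Legal S v = ∃[ u ] v ~ u × ¬ TotallyDominates S u

  -- GameValue p S k: with p to move and S already selected, exactly k further
  -- moves are made under optimal play.  For every S there is exactly one such
  -- k, since each move enlarges the set of totally dominated vertices.
  data GameValue (p : Player) (S : Subset n) : ℕ → Set where
    over : (∀ v → ¬ Legal S v) → GameValue p S 0
    move : ∀ {k} v → Legal S v → GameValue (opponent p) (S ∪ ⁅ v ⁆) k →
           (∀ w → Legal S w →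
              ∃[ j ] GameValue (opponent p) (S ∪ ⁅ w ⁆) j × Prefers p k j) →
           GameValue p S (suc k)

  IsGameTotalDominationNumber : ℕ → Set
  IsGameTotalDominationNumber = GameValue dominator ⊥

-- γ_tg(F) = γ_t(F) is expressed as: some k is the value of both invariants.
γtg-Perfect : ∀ {n} → Graph n → Set₁
γtg-Perfect G =
  ∀ {m} (F : Graph m) → F InducedSubgraphOf G → IsolateFree F →
  ∃[ k ] IsGameTotalDominationNumber F k × IsTotalDominationNumber F k

{-# OPTIONS --safe #-}

-- Suppose F is isolate-free, P₄-free and co-2P₃-free.  Components have diameter
-- at most 2, and every vertex v has a neighbour v′ such that v and v′ together
-- totally dominate the component of v.  One of v, v′ is good, meaning that it is
-- a twin of all its non-neighbours in the component: otherwise each of them lies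
-- in an induced co-P₃, and as P₄-freeness makes these two co-P₃ completely
-- joined, they form a co-2P₃.  After a good vertex is played, any later legal
-- move in its component finishes that component.  So Dominator can ensure two
-- moves per component, answering Staller's opening move v by v′ and opening
-- components himself by good vertices, whereas any total dominating set has
-- two vertices in each component.
--
-- Conversely, γₜ ≤ 2 for both P₄ and co-2P₃, while Staller can answer any first
-- move so that a third one is needed.

module Submission where

open import Defs
open import Data.Bool.Base using (if_then_else_)
open import Data.Empty using (⊥-elim) renaming (⊥ to Empty)
open import Data.Fin.Base using (Fin; zero; suc; _<_)
open import Data.Fin.Patterns using (0F; 1F; 2F; 3F)
open import Data.Fin.Properties using (any?; all?; <-cmp) renaming (_≟_ to _≟ᶠ_)
open import Data.Fin.Subset
  using (Subset; inside; outside; _∈_; _⊆_; _⊂_; _∪_; _-_; ⁅_⁆; ∣_∣; ⊥)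
open import Data.Fin.Subset.Induction using (⊃-wellFounded; Acc; acc)
open import Data.Fin.Subset.Properties
  using (_∈?_; x∈⁅x⁆; p⊆p∪q; q⊆p∪q; ∪-identityʳ; x∈p∧x≢y⇒x∈p-y; x∈p⇒∣p-x∣<∣p∣; ∣⊥∣≡0)
open import Data.List.Base using (List; []; _∷_; allFin; tabulate)
open import Data.List.Membership.Propositional.Properties using (∈-allFin)
open import Data.List.Relation.Unary.All as All using (All; []; _∷_)
open import Data.List.Relation.Unary.All.Properties using (tabulate⁻)
open import Data.List.Relation.Unary.AllPairs using (AllPairs; []; _∷_)
open import Data.Nat.Base using (ℕ; zero; suc; _+_; _≤_; z≤n; s≤s; s<s⁻¹)
open import Data.Nat.Properties
  using (n≤1+n; <⇒≱; ≤-refl; ≤-trans; ≤-reflexive; ≤-total; ≤-antisym;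
         +-suc; +-identityʳ; +-monoˡ-≤; module ≤-Reasoning)
open import Data.Product.Base using (_×_; _,_; ∃-syntax; proj₁; proj₂)
open import Data.Sum.Base as Sum using (_⊎_; inj₁; inj₂; [_,_]′)
open import Data.Vec.Base using (_∷_; []; lookup)
open import Function.Base using (_∘_; id)
open import Function.Bundles using (_⇔_; mk⇔; Equivalence)
open import Function.Construct.Composition using (_⇔-∘_)
open import Level using (0ℓ)
open import Relation.Binary.Core using (Rel)
open import Relation.Binary.Definitions using (tri<; tri≈; tri>)
open import Relation.Binary.PropositionalEquality using (_≡_; _≢_; refl; sym; subst)
open import Relation.Nullary.Decidable
  using (Dec; yes; no; does; _×-dec_; _⊎-dec_; ¬?; toWitness; decidable-stable)
open import Relation.Nullary.Negation using (¬_; contradiction)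

open Equivalence using (to; from)

-- Ordered pairs in tabulated lists and sizes of subsets

allPairs-tabulate⁻ : ∀ {A : Set} {R : Rel A 0ℓ} {n} {f : Fin n → A} →
                     AllPairs R (tabulate f) → ∀ {i j} → i < j → R (f i) (f j)
allPairs-tabulate⁻ (ps ∷ _)  {zero}  {suc j} _   = tabulate⁻ ps j
allPairs-tabulate⁻ (_ ∷ pss) {suc i} {suc j} i<j = allPairs-tabulate⁻ pss (s<s⁻¹ i<j)

∣p∪⁅x⁆∣≤1+∣p∣ : ∀ {n} (p : Subset n) x → ∣ p ∪ ⁅ x ⁆ ∣ ≤ suc ∣ p ∣
∣p∪⁅x⁆∣≤1+∣p∣ (inside ∷ p)  zero    rewrite ∪-identityʳ p = s≤s (n≤1+n _)
∣p∪⁅x⁆∣≤1+∣p∣ (outside ∷ p) zero    rewrite ∪-identityʳ p = ≤-refl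
∣p∪⁅x⁆∣≤1+∣p∣ (inside ∷ p)  (suc x) = s≤s (∣p∪⁅x⁆∣≤1+∣p∣ p x)
∣p∪⁅x⁆∣≤1+∣p∣ (outside ∷ p) (suc x) = ∣p∪⁅x⁆∣≤1+∣p∣ p x

k≤∣p-x∣⇒1+k≤∣p∣ : ∀ {n k} {p : Subset n} {x} → x ∈ p → k ≤ ∣ p - x ∣ → suc k ≤ ∣ p ∣
k≤∣p-x∣⇒1+k≤∣p∣ x∈p k≤ = ≤-trans (s≤s k≤) (x∈p⇒∣p-x∣<∣p∣ x∈p)

-- Induced subgraphs

inducedSubgraph-trans : ∀ {l m n} {H : Graph l} {F : Graph m} {G : Graph n} →
  H InducedSubgraphOf F → F InducedSubgraphOf G → H InducedSubgraphOf G
inducedSubgraph-trans (f , f-inj , f-adj) (g , g-inj , g-adj) =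
  g ∘ f , f-inj ∘ g-inj , λ x y → g-adj (f x) (f y) ⇔-∘ f-adj x y

-- Distinct vertices have distinct neighbourhoods, so that maps preserving and
-- reflecting adjacency are injective.
PointDetermining : ∀ {m} → Graph m → Set
PointDetermining H = ∀ i j → i ≡ j ⊎ ∃[ k ]
  ((i ~ k × ¬ (j ~ k)) ⊎ (j ~ k × ¬ (i ~ k)))
  where open Graph H

pointDetermining? : ∀ {m} (H : Graph m) → Dec (PointDetermining H)
pointDetermining? H = all? λ i → all? λ j → (i ≟ᶠ j) ⊎-dec any? λ k →
  (i ~? k ×-dec ¬? (j ~? k)) ⊎-dec (j ~? k ×-dec ¬? (i ~? k))
  where open Graph H

module _ {m n} (H : Graph m) (G : Graph n) where
  private
    module H = Graph H
    module G = Graph G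

  -- For a concrete `H` the conditional reduces, so each pair asks for a plain adjacency or
  -- non-adjacency in `G`.
  SameAdjacency : (Fin m → Fin n) → Rel (Fin m) 0ℓ
  SameAdjacency f i j = if does (i H.~? j) then f i G.~ f j else ¬ (f i G.~ f j)

  sameAdjacency⇒⇔ : ∀ f {i j} → SameAdjacency f i j → (i H.~ j) ⇔ (f i G.~ f j)
  sameAdjacency⇒⇔ f {i} {j} s with i H.~? j
  ... | yes i~j = mk⇔ (λ _ → s) (λ _ → i~j)
  ... | no  i≁j = mk⇔ (λ i~j → contradiction i~j i≁j) (λ fi~fj → contradiction fi~fj s)

  inducedSubgraph : PointDetermining H → ∀ f → AllPairs (SameAdjacency f) (allFin m) →
                    H InducedSubgraphOf G
  inducedSubgraph determining f pairs = f , injective , adjacency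
    where
    adjacency : ∀ i j → (i H.~ j) ⇔ (f i G.~ f j)
    adjacency i j with <-cmp i j
    ... | tri< i<j _ _ = sameAdjacency⇒⇔ f (allPairs-tabulate⁻ pairs i<j)
    ... | tri≈ _ refl _ = mk⇔ (λ i~i → contradiction i~i (H.~-irrefl refl))
                              (λ fi~fi → contradiction fi~fi (G.~-irrefl refl))
    ... | tri> _ _ j<i = mk⇔ (G.~-sym ∘ to j⇔i ∘ H.~-sym) (H.~-sym ∘ from j⇔i ∘ G.~-sym)
      where j⇔i = sameAdjacency⇒⇔ f (allPairs-tabulate⁻ pairs j<i)

    transport : ∀ {i j} → f i ≡ f j → ∀ {k} → i H.~ k → j H.~ k
    transport {i} {j} fi≡fj {k} i~k =
      from (adjacency j k) (subst (G._~ f k) fi≡fj (to (adjacency i k) i~k))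

    injective : ∀ {i j} → f i ≡ f j → i ≡ j
    injective {i} {j} fi≡fj with determining i j
    ... | inj₁ i≡j = i≡j
    ... | inj₂ (_ , inj₁ (i~k , j≁k)) = contradiction (transport fi≡fj i~k) j≁k
    ... | inj₂ (_ , inj₂ (j~k , i≁k)) = contradiction (transport (sym fi≡fj) j~k) i≁k

co2P₃ : Graph 6
co2P₃ = complement (disjointUnion (path 3) (path 3))

-- The total domination game on an arbitrary graph

module Game {n} (F : Graph n) where
  private module F = Graph F

  Dominates : Subset n → Fin n → Set
  Dominates = TotallyDominates F

  dominates? : ∀ S u → Dec (Dominates S u)
  dominates? S u = any? λ w → (w ∈? S) ×-dec (w F.~? u)

  legal? : ∀ S v → Dec (Legal F S v)
  legal? S v = any? λ u → (v F.~? u) ×-dec ¬? (dominates? S u)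

  dominates-mono : ∀ {S S′ u} → S ⊆ S′ → Dominates S u → Dominates S′ u
  dominates-mono S⊆S′ (w , w∈S , w~u) = w , S⊆S′ w∈S , w~u

  dominates-selected : ∀ {S v u} → v F.~ u → Dominates (S ∪ ⁅ v ⁆) u
  dominates-selected {S} {v} v~u = v , q⊆p∪q S ⁅ v ⁆ (x∈⁅x⁆ v) , v~u

  illegal⇒dominates : ∀ {S v u} → ¬ Legal F S v → v F.~ u → Dominates S u
  illegal⇒dominates {S} {v} {u} illegal v~u =
    decidable-stable (dominates? S u) λ u∉ → illegal (u , v~u , u∉)

  legal⇒⊂ : ∀ {S v} → Legal F S v → S ⊂ S ∪ ⁅ v ⁆
  legal⇒⊂ {S} {v} (_ , v~u , u∉) =
    p⊆p∪q ⁅ v ⁆ , v , q⊆p∪q S ⁅ v ⁆ (x∈⁅x⁆ v) , λ v∈S → u∉ (v , v∈S , v~u)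

  prefers-total : ∀ p j k → Prefers p j k ⊎ Prefers p k j
  prefers-total dominator j k = ≤-total j k
  prefers-total staller   j k = ≤-total k j

  prefers-refl : ∀ p {k} → Prefers p k k
  prefers-refl dominator = ≤-refl
  prefers-refl staller   = ≤-refl

  prefers-trans : ∀ p {i j k} → Prefers p i j → Prefers p j k → Prefers p i k
  prefers-trans dominator i≤j j≤k = ≤-trans i≤j j≤k
  prefers-trans staller   j≤i k≤j = ≤-trans k≤j j≤i

  -- Abstracted from legal moves to predicates on any `Fin m`, so that `best` can recurse on `m`.
  Best : Player → ∀ {m} → (Fin m → Set) → (Fin m → ℕ → Set) → Set
  Best p P Q = ∃[ v ] ∃[ k ] P v × Q v k × (∀ w → P w → ∃[ j ] Q w j × Prefers p k j)

  best : ∀ p {m} {P : Fin m → Set} {Q : Fin m → ℕ → Set} → (∀ v → Dec (P v)) →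
         (∀ v → P v → ∃[ k ] Q v k) → (∀ v → ¬ P v) ⊎ Best p P Q
  best p {zero}  P? value = inj₁ λ ()
  best p {suc m} {P} {Q} P? value
    with P? zero | best p (P? ∘ suc) (value ∘ suc)
  ... | no ¬P0 | inj₁ none = inj₁ λ { zero → ¬P0 ; (suc v) → none v }
  ... | no ¬P0 | inj₂ (v , k , Pv , Qvk , opt) =
    inj₂ (suc v , k , Pv , Qvk , λ { zero P0 → contradiction P0 ¬P0 ; (suc w) → opt w })
  ... | yes P0 | inj₁ none with value zero P0
  ...   | k , Q0k = inj₂ (zero , k , P0 , Q0k ,
    λ { zero _ → k , Q0k , prefers-refl p ; (suc w) Pw → contradiction Pw (none w) })
  best p {suc m} {P} {Q} P? value | yes P0 | inj₂ (v , k , Pv , Qvk , opt)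
    with value zero P0
  ... | i , Q0i with prefers-total p i k
  ...   | inj₁ i≼k = inj₂ (zero , i , P0 , Q0i , λ
    { zero    _  → i , Q0i , prefers-refl p
    ; (suc w) Pw → let j , Qwj , k≼j = opt w Pw in j , Qwj , prefers-trans p i≼k k≼j })
  ...   | inj₂ k≼i = inj₂ (suc v , k , Pv , Qvk , λ
    { zero _ → i , Q0i , k≼i ; (suc w) → opt w })

  -- Each legal move adds a new vertex to `S`, so backward induction over supersets terminates.
  gameValue : ∀ p S → ∃[ k ] GameValue F p S k
  gameValue p S = go p S (⊃-wellFounded S)
    where
    go : ∀ p S → Acc (λ A B → B ⊂ A) S → ∃[ k ] GameValue F p S k
    go p S (acc rec)
      with best p (legal? S) (λ v l → go (opponent p) (S ∪ ⁅ v ⁆) (rec (legal⇒⊂ l)))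
    ... | inj₁ none = 0 , over none
    ... | inj₂ (v , k , l , g , opt) = suc k , move v l g opt

  -- When no move is left, the selected vertices dominate everything, and each move has added at
  -- most one of them. From the empty set this gives γₜ ≤ γₜ_g.
  finalSet : IsolateFree F → ∀ {p S k} → GameValue F p S k →
             ∃[ T ] TotalDominatingSet F T × ∣ T ∣ ≤ ∣ S ∣ + k
  finalSet isolateFree {S = S} (over none) =
    S ,
    (λ u → let w , u~w = isolateFree u in illegal⇒dominates (none w) (F.~-sym u~w)) ,
    ≤-reflexive (sym (+-identityʳ ∣ S ∣))
  finalSet isolateFree {S = S} (move {k} v _ g _) =
    let T , dom , ∣T∣≤ = finalSet isolateFree g
    in T , dom , (begin
         ∣ T ∣              ≤⟨ ∣T∣≤ ⟩
         ∣ S ∪ ⁅ v ⁆ ∣ + k  ≤⟨ +-monoˡ-≤ k (∣p∪⁅x⁆∣≤1+∣p∣ S v) ⟩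
         suc ∣ S ∣ + k      ≡⟨ +-suc ∣ S ∣ k ⟨
         ∣ S ∣ + suc k      ∎)
    where open ≤-Reasoning

  LastsThreeMoves : Set
  LastsThreeMoves =
    (∃[ u ] Legal F ⊥ u) × ∀ v →
      ∃[ w ] Legal F (⊥ ∪ ⁅ v ⁆) w × ∃[ x ] Legal F ((⊥ ∪ ⁅ v ⁆) ∪ ⁅ w ⁆) x

  lastsThreeMoves⇒k≥3 : LastsThreeMoves → ∀ {k} → GameValue F dominator ⊥ k → 3 ≤ k
  lastsThreeMoves⇒k≥3 ((u , l) , _) (over none) = contradiction l (none u)
  lastsThreeMoves⇒k≥3 (_ , third) (move v _ (over none) _) =
    let w , l , _ = third v in contradiction l (none w)
  lastsThreeMoves⇒k≥3 (_ , third) (move v _ (move _ _ _ opt) _)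
    with third v
  -- Staller's optimal move is worth no less than the answer `w`, after which `x` is still playable.
  ... | w , l , x , l′ with opt w l
  ...   | _ , over none , _ = contradiction l′ (none x)
  ...   | _ , move _ _ _ _ , s≤s j≤k = s≤s (s≤s (s≤s z≤n))

-- Graphs without induced P₄ and co-2P₃

module Structure {n} (F : Graph n) (isolateFree : IsolateFree F)
                 (P₄-free : path 4 -Free F) (co2P₃-free : co2P₃ -Free F) where
  open Graph F

  _≁_ : Rel (Fin n) 0ℓ
  x ≁ y = ¬ (x ~ y)

  ≁-sym : ∀ {x y} → x ≁ y → y ≁ x
  ≁-sym x≁y = x≁y ∘ ~-sym

  noP₄ : ∀ {a b c d} → a ~ b → b ~ c → c ~ d → a ≁ c → b ≁ d → a ≁ d → Empty
  noP₄ {a} {b} {c} {d} ab bc cd ac bd ad = P₄-free (inducedSubgraph (path 4) F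
    (toWitness {a? = pointDetermining? (path 4)} _)
    (lookup (a ∷ b ∷ c ∷ d ∷ []))
    ((ab ∷ ac ∷ ad ∷ []) ∷ (bc ∷ bd ∷ []) ∷ (cd ∷ []) ∷ [] ∷ []))

  -- In a P₄-free graph without isolated vertices, lying in the same component.
  Near : Rel (Fin n) 0ℓ
  Near x y = x ~ y ⊎ ∃[ z ] x ~ z × z ~ y

  near? : ∀ x y → Dec (Near x y)
  near? x y = (x ~? y) ⊎-dec any? λ z → (x ~? z) ×-dec (z ~? y)

  near-refl : ∀ {x} → Near x x
  near-refl {x} = let y , x~y = isolateFree x in inj₂ (y , x~y , ~-sym x~y)

  near-sym : ∀ {x y} → Near x y → Near y x
  near-sym (inj₁ xy)            = inj₁ (~-sym xy)
  near-sym (inj₂ (z , xz , zy)) = inj₂ (z , ~-sym zy , ~-sym xz)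

  -- A walk `x`, `w`, `y`, `z` with no shortcut would be an induced P₄; this bounds distances in a
  -- component by 2.
  near-step : ∀ {x y z} → Near x y → y ~ z → Near x z
  near-step (inj₁ xy) yz = inj₂ (_ , xy , yz)
  near-step {x} {y} {z} (inj₂ (w , xw , wy)) yz with x ~? y | x ~? z | w ~? z
  ... | yes xy | _      | _      = inj₂ (y , xy , yz)
  ... | _      | yes xz | _      = inj₁ xz
  ... | _      | _      | yes wz = inj₂ (w , xw , wz)
  ... | no xy  | no xz  | no wz  = ⊥-elim (noP₄ xw wy yz xy wz xz)

  near-trans : ∀ {x y z} → Near x y → Near y z → Near x z
  near-trans xy (inj₁ yz)            = near-step xy yz
  near-trans xy (inj₂ (_ , yw , wz)) = near-step (near-step xy yw) wz

  DominatingPair : Rel (Fin n) 0ℓ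
  DominatingPair p q = p ~ q × (∀ {s} → Near p s → s ~ p ⊎ s ~ q)

  dominatingPair-sym : ∀ {p q} → DominatingPair p q → DominatingPair q p
  dominatingPair-sym (pq , dom) =
    ~-sym pq , λ qs → Sum.swap (dom (near-trans (inj₁ pq) qs))

  -- p and q form a dominating pair iff no path of length at most 2 joins them in
  -- the complement of their component, and complements of P₄-free graphs are
  -- P₄-free; hence the relation is invariant under steps in the complement.
  dominatingPair-step : ∀ {p q r} → DominatingPair p q → Near p r → p ≁ r →
                        DominatingPair r q
  dominatingPair-step {p} {q} {r} (pq , dom) pr p≁r = rq , dom′
    where
    rq : r ~ q
    rq = [ (λ rp → contradiction (~-sym rp) p≁r) , id ]′ (dom pr)

    dom′ : ∀ {s} → Near r s → s ~ r ⊎ s ~ q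
    dom′ {s} rs with s ~? r | s ~? q | dom (near-trans pr rs)
    ... | yes sr | _      | _       = inj₁ sr
    ... | _      | yes sq | _       = inj₂ sq
    ... | no s≁r | no s≁q | inj₂ sq = contradiction sq s≁q
    ... | no s≁r | no s≁q | inj₁ sp =
      ⊥-elim (noP₄ rq (~-sym pq) (~-sym sp) (≁-sym p≁r) (≁-sym s≁q) (≁-sym s≁r))

  -- The sets N(v′) ∖ N(v), for v′ ∈ N(v), form a chain, so finitely many of them
  -- have their union among them.
  commonPartner : ∀ v (us : List (Fin n)) →
    ∃[ v′ ] v ~ v′ × All (λ u → Near v u → u ~ v ⊎ u ~ v′) us
  commonPartner v []       = let v′ , vv′ = isolateFree v in v′ , vv′ , []
  commonPartner v (u ∷ us) with commonPartner v us
  ... | v′ , vv′ , dom with u ~? v | u ~? v′ | near? v u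
  ...   | yes uv | _       | _      = v′ , vv′ , (λ _ → inj₁ uv) ∷ dom
  ...   | _      | yes uv′ | _      = v′ , vv′ , (λ _ → inj₂ uv′) ∷ dom
  ...   | _      | _       | no vu  = v′ , vv′ , (λ vu′ → contradiction vu′ vu) ∷ dom
  ...   | no u≁v | _       | yes (inj₁ vu) = contradiction (~-sym vu) u≁v
  ...   | no u≁v | no u≁v′ | yes (inj₂ (w , vw , wu)) =
    w , vw , (λ _ → inj₂ (~-sym wu)) ∷ All.map (λ d → [ inj₁ , enlarge ]′ ∘ d) dom
    where
    wv′ : w ~ v′
    wv′ = decidable-stable (w ~? v′) λ w≁v′ →
      noP₄ (~-sym wu) (~-sym vw) vv′ u≁v w≁v′ u≁v′

    enlarge : ∀ {x} → x ~ v′ → x ~ v ⊎ x ~ w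
    enlarge {x} xv′ with x ~? v | x ~? w | x ~? u
    ... | yes xv | _      | _      = inj₁ xv
    ... | _      | yes xw | _      = inj₂ xw
    ... | no x≁v | no x≁w | no x≁u =
      ⊥-elim (noP₄ xv′ (~-sym wv′) wu x≁w (≁-sym u≁v′) x≁u)
    ... | no x≁v | no x≁w | yes xu =
      ⊥-elim (noP₄ vv′ (~-sym xv′) xu (≁-sym x≁v) (≁-sym u≁v′) (≁-sym u≁v))

  partner : ∀ v → ∃[ v′ ] DominatingPair v v′
  partner v =
    let v′ , vv′ , dom = commonPartner v (allFin n)
    in v′ , vv′ , λ {s} → All.lookup dom (∈-allFin s)

  -- Good vertices

  Good : Fin n → Set
  Good v = ∀ {u} → Near v u → v ≁ u → ∀ w → (v ~ w) ⇔ (u ~ w)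

  record CoP₃ (a b c : Fin n) : Set where
    constructor coP₃
    field
      ends    : a ~ c
      centreˡ : a ≁ b
      centreʳ : b ≁ c

  -- The clause on dominating pairs is what reaching `a`, `b` and `c` from `v` by complement steps
  -- yields; it serves to join two such triples completely.
  Bad : Fin n → Set
  Bad v = ∃[ a ] ∃[ b ] ∃[ c ] CoP₃ a b c ×
    (∀ {q} → DominatingPair v q → DominatingPair a q × DominatingPair b q × DominatingPair c q)

  -- A vertex `w` that distinguishes `v` from a non-neighbour `u` makes a co-P₃ of `u`, `v`, `w`,
  -- all within two complement steps of `v`.
  good-or-bad : ∀ v → Good v ⊎ Bad v
  good-or-bad v with (any? λ u → any? λ w → near? v u ×-dec ¬? (v ~? u) ×-dec
    (((v ~? w) ×-dec ¬? (u ~? w)) ⊎-dec ((u ~? w) ×-dec ¬? (v ~? w))))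
  ... | yes (u , w , vu , v≁u , inj₁ (vw , u≁w)) =
    inj₂ (v , u , w , coP₃ vw v≁u u≁w , λ d →
      let d′ = dominatingPair-step d vu v≁u
      in d , d′ , dominatingPair-step d′ (near-trans (near-sym vu) (inj₁ vw)) u≁w)
  ... | yes (u , w , vu , v≁u , inj₂ (uw , v≁w)) =
    inj₂ (u , v , w , coP₃ uw (≁-sym v≁u) v≁w , λ d →
      dominatingPair-step d vu v≁u , d , dominatingPair-step d (near-step vu uw) v≁w)
  ... | no none = inj₁ λ {u} vu v≁u w → mk⇔
    (λ vw → decidable-stable (u ~? w) λ u≁w → none (u , w , vu , v≁u , inj₁ (vw , u≁w)))
    (λ uw → decidable-stable (v ~? w) λ v≁w → none (u , w , vu , v≁u , inj₂ (uw , v≁w)))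

  -- If `v` and `v′` are both bad, the pair `v`, `v′` can be moved at one end to `a`, `b`, `c` and
  -- then at the other to `x`, `y`, `z`. All nine resulting pairs are adjacent, which gives a
  -- co-2P₃.
  goodNear : ∀ v → ∃[ g ] Good g × Near v g
  goodNear v with partner v
  ... | v′ , pair with good-or-bad v | good-or-bad v′
  ...   | inj₁ good | _         = v , good , near-refl
  ...   | _         | inj₁ good = v′ , good , inj₁ (proj₁ pair)
  ...   | inj₂ (a , b , c , coP₃ ac a≁b b≁c , pairs) | inj₂ (x , y , z , coP₃ xz x≁y y≁z , pairs′) =
    let av′ , bv′ , cv′ = pairs pair
        ax , ay , az = row av′
        bx , by , bz = row bv′
        cx , cy , cz = row cv′
    in ⊥-elim (co2P₃-free (inducedSubgraph co2P₃ F
         (toWitness {a? = pointDetermining? co2P₃} _)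
         (lookup (a ∷ b ∷ c ∷ x ∷ y ∷ z ∷ []))
         ((a≁b ∷ ac ∷ ax ∷ ay ∷ az ∷ []) ∷ (b≁c ∷ bx ∷ by ∷ bz ∷ []) ∷
          (cx ∷ cy ∷ cz ∷ []) ∷ (x≁y ∷ xz ∷ []) ∷ (y≁z ∷ []) ∷ [] ∷ [])))
    where
    row : ∀ {p} → DominatingPair p v′ → p ~ x × p ~ y × p ~ z
    row d = let dx , dy , dz = pairs′ (dominatingPair-sym d)
            in ~-sym (proj₁ dx) , ~-sym (proj₁ dy) , ~-sym (proj₁ dz)

  -- Dominator's strategy

  open Game F

  -- An upper bound for the remaining game: R holds one vertex for each move that
  -- is still to be allowed in a component.
  data Status (S R : Subset n) (x : Fin n) : Set where
    done  : (∀ {y} → Near x y → Dominates S y) → Status S R x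
    half  : ∀ g r → Good g → Near x g → (∀ {y} → g ~ y → Dominates S y) →
            r ∈ R → Near x r → Status S R x
    fresh : ∀ r r′ → r ≢ r′ → r ∈ R → r′ ∈ R → Near x r → Near x r′ → Status S R x

  Invariant : Rel (Subset n) 0ℓ
  Invariant S R = ∀ x → Status S R x

  status-near : ∀ {S R x y} → Near y x → Status S R x → Status S R y
  status-near yx (done d) = done λ yz → d (near-trans (near-sym yx) yz)
  status-near yx (half g r good xg d r∈R xr) =
    half g r good (near-trans yx xg) d r∈R (near-trans yx xr)
  status-near yx (fresh r r′ r≢r′ r∈R r′∈R xr xr′) =
    fresh r r′ r≢r′ r∈R r′∈R (near-trans yx xr) (near-trans yx xr′)

  -- The vertex `r` lies in another component, so the vertices reserved for this one stay in `R`.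
  status-elsewhere : ∀ {S S′ R x r} → S ⊆ S′ → ¬ Near x r → Status S R x → Status S′ (R - r) x
  status-elsewhere {R = R} {x} {r} S⊆S′ x≁r status = go status
    where
    keep : ∀ {s} → s ∈ R → Near x s → s ∈ R - r
    keep s∈R xs = x∈p∧x≢y⇒x∈p-y s∈R λ { refl → x≁r xs }

    go : Status _ R x → Status _ (R - r) x
    go (done d) = done (dominates-mono S⊆S′ ∘ d)
    go (half g s good xg d s∈R xs) =
      half g s good xg (dominates-mono S⊆S′ ∘ d) (keep s∈R xs) xs
    go (fresh s s′ s≢s′ s∈R s′∈R xs xs′) =
      fresh s s′ s≢s′ (keep s∈R xs) (keep s′∈R xs′) xs xs′

  invariant-update : ∀ {S S′ R r} x → Invariant S R → S ⊆ S′ → Near x r →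
                     Status S′ (R - r) x → Invariant S′ (R - r)
  invariant-update {r = r} x inv S⊆S′ xr status y with near? y r
  ... | yes yr = status-near (near-trans yr (near-sym xr)) status
  ... | no  yr = status-elsewhere S⊆S′ yr (inv y)

  -- The newly dominated `u` is not a neighbour of `g`, hence is its twin, so `v` is adjacent to
  -- `g`. Every other non-neighbour of `g` in the component is a twin too, hence adjacent to `v`.
  half-completed : ∀ {S g v u} → Good g → Near v g → (∀ {y} → g ~ y → Dominates S y) →
                   v ~ u → ¬ Dominates S u → ∀ {y} → Near v y → Dominates (S ∪ ⁅ v ⁆) y
  half-completed {S} {g} {v} {u} good vg d vu u∉ {y} vy with g ~? y
  ... | yes gy = dominates-mono (p⊆p∪q ⁅ v ⁆) (d gy)
  ... | no g≁y = dominates-selected (~-sym (to (good gy′ g≁y v) gv))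
    where
    gy′ : Near g y
    gy′ = near-trans (near-sym vg) vy

    gv : g ~ v
    gv = from (good (near-step (near-sym vg) vu) (u∉ ∘ d) v) (~-sym vu)

  pair-completed : ∀ {S v v′} → DominatingPair v v′ →
    (∀ {y} → v ~ y → Dominates S y) → (∀ {y} → v′ ~ y → Dominates S y) →
    ∀ {y} → Near v y → Dominates S y
  pair-completed (_ , dom) d d′ vy = [ d ∘ ~-sym , d′ ∘ ~-sym ]′ (dom vy)

  -- By induction on the play, each move costing one vertex of `R`. In a `fresh` component the
  -- optimal value is compared with opening by a good vertex, or with answering Staller's `v` by its
  -- partner.
  dominator-bound : ∀ {S R k} → Invariant S R → GameValue F dominator S k → k ≤ ∣ R ∣
  staller-bound   : ∀ {S R k} → Invariant S R → GameValue F staller S k → k ≤ ∣ R ∣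

  dominator-bound inv (over _) = z≤n
  dominator-bound {S} inv (move v (u , vu , u∉) gv opt) with inv v
  ... | done d = contradiction (d (inj₁ vu)) u∉
  ... | half g r good vg d r∈R vr = k≤∣p-x∣⇒1+k≤∣p∣ r∈R (staller-bound
    (invariant-update v inv (p⊆p∪q ⁅ v ⁆) vr (done (half-completed good vg d vu u∉))) gv)
  ... | fresh r r′ r≢r′ r∈R r′∈R vr vr′ with goodNear v
  ...   | g , good , vg with legal? S g
  -- All neighbours of `g` are then dominated, as if `g` had been played, so `v` completes the
  -- component.
  ...     | no illegal = k≤∣p-x∣⇒1+k≤∣p∣ r∈R (staller-bound
    (invariant-update v inv (p⊆p∪q ⁅ v ⁆) vr
      (done (half-completed good vg (illegal⇒dominates illegal) vu u∉))) gv)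
  ...     | yes legal with opt g legal
  ...       | j , gj , k≤j = k≤∣p-x∣⇒1+k≤∣p∣ r∈R (≤-trans k≤j (staller-bound
    (invariant-update v inv (p⊆p∪q ⁅ g ⁆) vr
      (half g r′ good vg dominates-selected (x∈p∧x≢y⇒x∈p-y r′∈R (r≢r′ ∘ sym)) vr′)) gj))

  staller-bound inv (over _) = z≤n
  staller-bound {S} {R} inv (move v (u , vu , u∉) gv _) with inv v
  ... | done d = contradiction (d (inj₁ vu)) u∉
  ... | half g r good vg d r∈R vr = k≤∣p-x∣⇒1+k≤∣p∣ r∈R (dominator-bound
    (invariant-update v inv (p⊆p∪q ⁅ v ⁆) vr (done (half-completed good vg d vu u∉))) gv)
  ... | fresh r r′ r≢r′ r∈R r′∈R vr vr′ = reply gv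
    where
    v′ = proj₁ (partner v)
    pair = proj₂ (partner v)
    S′ = S ∪ ⁅ v ⁆

    r′∈R-r : r′ ∈ R - r
    r′∈R-r = x∈p∧x≢y⇒x∈p-y r′∈R (r≢r′ ∘ sym)

    completed : ∀ {T} → S ⊆ T → (∀ {y} → Near v y → Dominates T y) →
                Invariant T (R - r - r′)
    -- `r` pays for `v` and `r′` for the reply, hence two updates.
    completed S⊆T d = invariant-update v
      (invariant-update v inv S⊆T vr (done d)) id vr′ (done d)

    reply : ∀ {k} → GameValue F dominator S′ k → suc k ≤ ∣ R ∣
    reply gv with legal? S′ v′
    ... | no illegal = k≤∣p-x∣⇒1+k≤∣p∣ r∈R (dominator-bound (invariant-update v inv (p⊆p∪q ⁅ v ⁆) vr
      (done (pair-completed pair dominates-selected (illegal⇒dominates illegal)))) gv)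
    reply (over none) | yes legal = contradiction legal (none v′)
    reply (move _ _ _ opt) | yes legal with opt v′ legal
    ... | j , gj , k≤j = k≤∣p-x∣⇒1+k≤∣p∣ r∈R (k≤∣p-x∣⇒1+k≤∣p∣ r′∈R-r (≤-trans k≤j (staller-bound
      (completed (p⊆p∪q ⁅ v′ ⁆ ∘ p⊆p∪q ⁅ v ⁆)
        (pair-completed pair (dominates-mono (p⊆p∪q ⁅ v′ ⁆) ∘ dominates-selected)
          dominates-selected)) gj)))

  -- A total dominating set can itself serve as `R`: it contains a neighbour `r` of `x` and a
  -- neighbour `r′` of `r`, two distinct vertices of the component.
  initial-invariant : ∀ {T} → TotalDominatingSet F T → Invariant ⊥ T
  initial-invariant dom x =
    let r  , r∈T  , rx  = dom x
        r′ , r′∈T , r′r = dom r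
    in fresh r r′ (λ r≡r′ → ~-irrefl (sym r≡r′) r′r) r∈T r′∈T
         (inj₁ (~-sym rx)) (inj₂ (r , ~-sym rx , ~-sym r′r))

  γtg≡γt : ∃[ k ] IsGameTotalDominationNumber F k × IsTotalDominationNumber F k
  γtg≡γt =
    let k , value = gameValue dominator ⊥
        T , dom , ∣T∣≤ = finalSet isolateFree value
        bound = λ S domS → dominator-bound (initial-invariant {S} domS) value
        ∣T∣≤k = subst (λ z → ∣ T ∣ ≤ z + k) (∣⊥∣≡0 n) ∣T∣≤
    in k , value , (T , dom , ≤-antisym ∣T∣≤k (bound T dom)) , bound

-- The forbidden graphs

totalDominatingSet? : ∀ {m} (H : Graph m) T → Dec (TotalDominatingSet H T)
totalDominatingSet? H T = all? (Game.dominates? H T)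

isolateFree? : ∀ {m} (H : Graph m) → Dec (IsolateFree H)
isolateFree? H = all? λ v → any? (Graph._~?_ H v)

lastsThreeMoves? : ∀ {m} (H : Graph m) → Dec (Game.LastsThreeMoves H)
lastsThreeMoves? H = any? (legal? ⊥) ×-dec all? λ v →
  any? λ w → legal? (⊥ ∪ ⁅ v ⁆) w ×-dec any? (legal? ((⊥ ∪ ⁅ v ⁆) ∪ ⁅ w ⁆))
  where open Game H

-- Perfection applied to `H` itself would give 3 ≤ `k` ≤ 2.
perfect⇒free : ∀ {m n} (H : Graph m) (G : Graph n) → IsolateFree H → ∀ T →
  TotalDominatingSet H T → ∣ T ∣ ≤ 2 → Game.LastsThreeMoves H → γtg-Perfect G → H -Free G
perfect⇒free H G isolateFree T dom ∣T∣≤2 lasts perfect sub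
  with perfect H sub isolateFree
... | k , value , _ , minimal =
  <⇒≱ (Game.lastsThreeMoves⇒k≥3 H lasts value) (≤-trans (minimal T dom) ∣T∣≤2)

proposition5p2 : ∀ (n : ℕ) (G : Graph n) → IsolateFree G →
    γtg-Perfect G ⇔
    ((path 4 -Free G) × (complement (disjointUnion (path 3) (path 3)) -Free G))
proposition5p2 n G _ = mk⇔
  (λ (perfect : γtg-Perfect G) → P₄-free perfect , co2P₃-free perfect)
  (λ (P₄-free , co2P₃-free) F sub isolateFree → Structure.γtg≡γt F isolateFree
    (λ s → P₄-free (inducedSubgraph-trans {H = path 4} {F} {G} s sub))
    (λ s → co2P₃-free (inducedSubgraph-trans {H = co2P₃} {F} {G} s sub)))
  where
  P₄-free : γtg-Perfect G → path 4 -Free G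
  P₄-free = perfect⇒free (path 4) G (toWitness {a? = isolateFree? (path 4)} _) T
    (toWitness {a? = totalDominatingSet? (path 4) T} _) ≤-refl
    (toWitness {a? = lastsThreeMoves? (path 4)} _)
    where T = ⁅ 1F ⁆ ∪ ⁅ 2F ⁆

  co2P₃-free : γtg-Perfect G → co2P₃ -Free G
  co2P₃-free = perfect⇒free co2P₃ G (toWitness {a? = isolateFree? co2P₃} _) T
    (toWitness {a? = totalDominatingSet? co2P₃ T} _) ≤-refl
    (toWitness {a? = lastsThreeMoves? co2P₃} _)
    -- One vertex from each P₃; in the complement each is adjacent to the whole other triple.
    where T = ⁅ 0F ⁆ ∪ ⁅ 3F ⁆
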